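{- For every pair $a,b$ of integers with $2\leq a\leq b$, there exists a connected graph $G$ such that $spvc(G)=a$ and $srvc(G)=b$.
   Context: All graphs are simple, finite and undirected. Vertex-colorings are arbitrary (adjacent vertices may receive the same color). A path in a vertex-colored graph is a vertex-proper path if any two adjacent internal vertices of the path differ in color, and a vertex-rainbow path if all its internal vertices have pairwise different colors (the end-vertices are not internal). A $u$-$v$ geodesic is a $u$-$v$ path of length $d(u,v)$. A vertex-colored graph is strong proper vertex-connected (respectively strong rainbow vertex-connected) if for any two distinct vertices $u,v$ there exists a vertex-proper (respectively vertex-rainbow) $u$-$v$ geodesic. For a connected graph $G$, $spvc(G)$ (respectively $srvc(G)$) is the smallest number of colors required to make $G$ strong proper vertex-connected (respectively strong rainbow vertex-connected). -}

module Defs where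

open import Data.Fin.Base using (Fin)
open import Data.List.Base using (List; []; _∷_; _++_; [_]; drop; length)
open import Data.List.Relation.Unary.AllPairs using (AllPairs)
open import Data.List.Relation.Unary.Linked using (Linked)
open import Data.List.Relation.Unary.Unique.Propositional using (Unique)
open import Data.Nat.Base using (ℕ; NonZero; _≤_)
open import Data.Product.Base using (Σ; ∃; _×_; proj₁)
open import Function.Base using (_on_)
open import Level using (0ℓ)
open import Relation.Binary.Construct.Closure.ReflexiveTransitive using (Star; ε; _◅_)
open import Relation.Binary.Core using (Rel)
open import Relation.Binary.Definitions using (Decidable; Irreflexive; Symmetric)
open import Relation.Binary.PropositionalEquality.Core using (_≡_; _≢_)

IsLeast : (ℕ → Set) → ℕ → Set
IsLeast P k = P k × (∀ j → P j → k ≤ j)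

record Graph : Set₁ where
  field
    order : ℕ

  Vertex : Set
  Vertex = Fin order

  field
    Adj    : Rel Vertex 0ℓ
    adj?   : Decidable Adj
    sym    : Symmetric Adj
    irrefl : Irreflexive _≡_ Adj

module _ (G : Graph) where
  open Graph G

  Walk : Rel Vertex 0ℓ
  Walk = Star Adj

  -- All vertices of the walk except its last one, so one per edge.
  sources : ∀ {u v} → Walk u v → List Vertex
  sources     ε       = []
  sources {u} (_ ◅ w) = u ∷ sources w

  vertices : ∀ {u v} → Walk u v → List Vertex
  vertices {v = v} w = sources w ++ [ v ]

  Path : Rel Vertex 0ℓ
  Path u v = Σ (Walk u v) λ w → Unique (vertices w)

  pathLength : ∀ {u v} → Path u v → ℕ
  pathLength p = length (sources (proj₁ p))

  internal : ∀ {u v} → Path u v → List Vertex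
  internal p = drop 1 (sources (proj₁ p))

  Connected : Set
  Connected = NonZero order × (∀ u v → Path u v)

  -- IsDistance u v d  says  d(u,v) = d.
  IsDistance : Vertex → Vertex → ℕ → Set
  IsDistance u v = IsLeast λ d → Σ (Path u v) λ p → pathLength p ≡ d

  IsGeodesic : ∀ {u v} → Path u v → Set
  IsGeodesic {u} {v} p = IsDistance u v (pathLength p)

  -- Adjacent vertices may receive the same colour.
  Coloring : ℕ → Set
  Coloring k = Vertex → Fin k

  module _ {k : ℕ} (c : Coloring k) where

    VertexProper : ∀ {u v} → Path u v → Set
    VertexProper p = Linked (_≢_ on c) (internal p)

    VertexRainbow : ∀ {u v} → Path u v → Set
    VertexRainbow p = AllPairs (_≢_ on c) (internal p)

    StrongProperVertexConnected : Set
    StrongProperVertexConnected =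
      ∀ u v → u ≢ v → Σ (Path u v) λ p → IsGeodesic p × VertexProper p

    StrongRainbowVertexConnected : Set
    StrongRainbowVertexConnected =
      ∀ u v → u ≢ v → Σ (Path u v) λ p → IsGeodesic p × VertexRainbow p

  -- The invariants as relations:  IsSpvc a  says  spvc(G) = a,  and
  -- IsSrvc b  says  srvc(G) = b.  Colourings need not be surjective; this
  -- does not change the least number of colours.
  IsSpvc : ℕ → Set
  IsSpvc = IsLeast λ k → ∃ λ (c : Coloring k) → StrongProperVertexConnected c

  IsSrvc : ℕ → Set
  IsSrvc = IsLeast λ k → ∃ λ (c : Coloring k) → StrongRainbowVertexConnected c

-- Attach a pendant vertex to every vertex of a connected graph H on b vertices.
-- Every geodesic between the pendants at i and j passes through i and j, and
-- through no other vertex when i and j are adjacent.  So every strong rainbow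
-- colouring is injective on H, every strong proper colouring is a proper
-- colouring of H, and both conditions are sufficient: the new graph has spvc
-- equal to the chromatic number of H and srvc equal to b.  For H we take a
-- complete multipartite graph with a parts, of which one is a singleton {hub}.
module Submission where

open import Defs
open import Data.Bool.Base using (if_then_else_)
open import Data.Fin.Base using (Fin; zero; suc; toℕ; fromℕ<; inject≤; splitAt; join)
open import Data.Fin.Properties using (_≟_; splitAt-join; join-splitAt; injective⇒≤; nonZeroIndex; toℕ-injective; toℕ-fromℕ<; toℕ-inject≤; toℕ≤pred[n])
open import Data.List.Base using ([]; _∷_; _++_; drop; length; map)
open import Data.List.Membership.Propositional using (_∈_)
open import Data.List.Relation.Unary.All as All using (All; []; _∷_)
import Data.List.Relation.Unary.All.Properties as All
open import Data.List.Relation.Unary.AllPairs as AllPairs using (AllPairs; []; _∷_)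
import Data.List.Relation.Unary.AllPairs.Properties as AllPairs
open import Data.List.Relation.Unary.Any using (here; there)
open import Data.List.Relation.Unary.Linked as Linked using (Linked; []; [-]; _∷_)
import Data.List.Relation.Unary.Linked.Properties as Linked
open import Data.List.Relation.Unary.Unique.Propositional using (Unique)
import Data.List.Relation.Unary.Unique.Propositional.Properties as Unique
open import Data.Nat.Base using (ℕ; suc; _≤_; z≤n; s≤s; s≤s⁻¹; _+_; _⊓_)
open import Data.Nat.Properties using (≤-reflexive; ≤-refl; ≤-trans; <⇒≱; m≤n⇒m≤1+n; n≤1+n; m⊓n≤n; m≤n⇒m⊓n≡m)
open import Data.Product.Base using (Σ; ∃; _×_; _,_; proj₁)
open import Data.Sum.Base using (_⊎_; inj₁; inj₂; [_,_]′)
open import Data.Sum.Properties using (inj₁-injective; inj₂-injective)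
open import Function.Base using (_∘_; _on_; id)
open import Level using (0ℓ)
open import Relation.Binary.Construct.Closure.ReflexiveTransitive using (ε; _◅_)
open import Relation.Binary.Core using (Rel)
open import Relation.Binary.Definitions using (Decidable; Irreflexive; Symmetric)
open import Relation.Binary.PropositionalEquality.Core using (_≡_; _≢_; refl; sym; trans; cong; subst; subst₂)
open import Relation.Nullary.Decidable using (yes; no; does; ¬?; decidable-stable; map′)
open import Relation.Nullary.Negation using (contradiction)

AllPairs-++⁻ˡ : ∀ {A : Set} {R : Rel A 0ℓ} xs {ys} → AllPairs R (xs ++ ys) → AllPairs R xs
AllPairs-++⁻ˡ []       _        = []
AllPairs-++⁻ˡ (x ∷ xs) (r ∷ rs) = All.++⁻ˡ xs r ∷ AllPairs-++⁻ˡ xs rs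

-- Injectivity is taken in contrapositive form, as colouring conditions yield inequations; decidable
-- equality recovers the usual form.
reflects-≢⇒≤ : ∀ {m n} (f : Fin m → Fin n) → (∀ {i j} → i ≢ j → f i ≢ f j) → m ≤ n
reflects-≢⇒≤ f f-≢ = injective⇒≤ {f = f} λ {i} {j} fi≡fj →
  decidable-stable (i ≟ j) λ i≢j → f-≢ i≢j fi≡fj

-- Paths, and certificates for geodesics.

module _ (G : Graph) where
  open Graph G

  sources-linked : ∀ {u v} (w : Walk G u v) → Linked Adj (sources G w)
  sources-linked ε               = []
  sources-linked (_ ◅ ε)         = [-]
  sources-linked (e ◅ w@(_ ◅ _)) = e ∷ sources-linked w

  internal-linked : ∀ {u v} (p : Path G u v) → Linked Adj (internal G p)
  internal-linked (ε     , _) = []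
  internal-linked (_ ◅ w , _) = sources-linked w

  internal-unique : ∀ {u v} (p : Path G u v) → Unique (internal G p)
  internal-unique (w , w!) = Unique.drop⁺ 1 (AllPairs-++⁻ˡ (sources G w) w!)

  -- A function D that vanishes at v and is 1-Lipschitz along edges bounds the
  -- distance to v from below.  D decreases along a walk that attains the bound,
  -- so such a walk repeats no vertex.
  module _ {v : Vertex} (D : Vertex → ℕ) (D-v : D v ≡ 0)
           (lipschitz : ∀ {x y} → Adj x y → D x ≤ suc (D y)) where

    D≤length : ∀ {u} (w : Walk G u v) → D u ≤ length (sources G w)
    D≤length ε       = ≤-reflexive D-v
    D≤length (e ◅ w) = ≤-trans (lipschitz e) (s≤s (D≤length w))

    All-D≤length : ∀ {u} (w : Walk G u v) →
      All (λ z → D z ≤ length (sources G w)) (vertices G w)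
    All-D≤length ε       = ≤-reflexive D-v ∷ []
    All-D≤length (e ◅ w) = D≤length (e ◅ w) ∷ All.map m≤n⇒m≤1+n (All-D≤length w)

    tight⇒unique : ∀ {u} (w : Walk G u v) → length (sources G w) ≤ D u → Unique (vertices G w)
    tight⇒unique ε       _     = [] ∷ []
    tight⇒unique (e ◅ w) tight =
      All.map (λ { Dz≤ refl → <⇒≱ tight Dz≤ }) (All-D≤length w) ∷
      tight⇒unique w (s≤s⁻¹ (≤-trans tight (lipschitz e)))

    tight⇒geodesic : ∀ {u} (w : Walk G u v) (tight : length (sources G w) ≤ D u) →
      IsGeodesic G (w , tight⇒unique w tight)
    tight⇒geodesic w tight =
      ((w , tight⇒unique w tight) , refl) , λ { _ ((w′ , _) , refl) → ≤-trans tight (D≤length w′) }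

-- f i is the part of i.
module Corona {n a : ℕ} (f : Fin n → Fin a)
              (hub : Fin n) (hub-alone : ∀ {i} → i ≢ hub → f i ≢ f hub) where

  -- The multipartite graph with pendants, and its distances.

  _~_ : Rel (Fin n) 0ℓ
  i ~ j = f i ≢ f j

  -- inj₁ i is the vertex i of H, and inj₂ i is the pendant at i.
  V : Set
  V = Fin n ⊎ Fin n

  data E : Rel V 0ℓ where
    base : ∀ {i j} → i ~ j → E (inj₁ i) (inj₁ j)
    down : ∀ {i} → E (inj₁ i) (inj₂ i)
    up   : ∀ {i} → E (inj₂ i) (inj₁ i)

  E? : Decidable E
  E? (inj₁ i) (inj₁ j) = map′ base (λ { (base r) → r }) (¬? (f i ≟ f j))
  E? (inj₁ i) (inj₂ j) = map′ (λ { refl → down }) (λ { down → refl }) (i ≟ j)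
  E? (inj₂ i) (inj₁ j) = map′ (λ { refl → up }) (λ { up → refl }) (i ≟ j)
  E? (inj₂ i) (inj₂ j) = no λ ()

  E-sym : Symmetric E
  E-sym (base r) = base (r ∘ sym)
  E-sym down     = up
  E-sym up       = down

  E-irrefl : Irreflexive _≡_ E
  E-irrefl refl (base r) = r refl

  view : Fin (n + n) → V
  view = splitAt n

  ⟦_⟧ : V → Fin (n + n)
  ⟦_⟧ = join n n

  view-⟦⟧ : ∀ x → view ⟦ x ⟧ ≡ x
  view-⟦⟧ = splitAt-join n n

  ⟦⟧-view : ∀ u → ⟦ view u ⟧ ≡ u
  ⟦⟧-view = join-splitAt n n

  ⟦⟧-injective : ∀ {x y} → ⟦ x ⟧ ≡ ⟦ y ⟧ → x ≡ y
  ⟦⟧-injective {x} {y} eq = trans (sym (view-⟦⟧ x)) (trans (cong view eq) (view-⟦⟧ y))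

  view≡⇒≡ : ∀ {u x} → view u ≡ x → u ≡ ⟦ x ⟧
  view≡⇒≡ {u} refl = sym (⟦⟧-view u)

  G : Graph
  G = record
    { order  = n + n
    ; Adj    = E on view
    ; adj?   = λ u v → E? (view u) (view v)
    ; sym    = E-sym
    ; irrefl = λ { refl → E-irrefl refl }
    }

  open Graph G using (Adj; Vertex)

  edge : ∀ {x y} → E x y → Adj ⟦ x ⟧ ⟦ y ⟧
  edge {x} {y} = subst₂ E (sym (view-⟦⟧ x)) (sym (view-⟦⟧ y))

  core : Fin n → Vertex
  core i = ⟦ inj₁ i ⟧

  -- The distance in H: distinct vertices of one part have the hub as a common neighbour.
  hdist : Fin n → Fin n → ℕ
  hdist i j = if does (i ≟ j) then 0 else if does (f i ≟ f j) then 2 else 1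

  -- A pendant end adds one, as its only neighbour is its base vertex. For equal pendants this count
  -- would give 2, hence the separate case.
  dist : V → V → ℕ
  dist (inj₁ i) (inj₁ j) = hdist i j
  dist (inj₁ i) (inj₂ j) = suc (hdist i j)
  dist (inj₂ i) (inj₁ j) = suc (hdist i j)
  dist (inj₂ i) (inj₂ j) = if does (i ≟ j) then 0 else suc (suc (hdist i j))

  hdist-refl : ∀ i → hdist i i ≡ 0
  hdist-refl i with i ≟ i
  ... | yes _   = refl
  ... | no i≢i = contradiction refl i≢i

  dist-refl : ∀ x → dist x x ≡ 0
  dist-refl (inj₁ i) = hdist-refl i
  dist-refl (inj₂ i) with i ≟ i
  ... | yes _   = refl
  ... | no i≢i = contradiction refl i≢i

  hdist-lipschitz : ∀ {i i′} j → i ~ i′ → hdist i j ≤ suc (hdist i′ j)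
  hdist-lipschitz {i} {i′} j r with i ≟ j | f i ≟ f j | i′ ≟ j | f i′ ≟ f j
  ... | yes _ | _     | _        | _     = z≤n
  ... | no _  | no _  | _        | _     = s≤s z≤n
  -- The only possible violation, 2 against 0: it would make `i` adjacent to a vertex of its own
  -- part.
  ... | no _  | yes q | yes refl | _     = contradiction q r
  ... | no _  | yes _ | no _     | yes _ = s≤s (s≤s z≤n)
  ... | no _  | yes _ | no _     | no _  = ≤-refl

  dist-lipschitz : ∀ {x x′} y → E x x′ → dist x y ≤ suc (dist x′ y)
  dist-lipschitz (inj₁ j) (base r) = hdist-lipschitz j r
  dist-lipschitz (inj₂ j) (base r) = s≤s (hdist-lipschitz j r)
  dist-lipschitz (inj₁ j) down     = m≤n⇒m≤1+n (n≤1+n _)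
  dist-lipschitz (inj₂ j) (down {i}) with i ≟ j
  ... | yes _ = ≤-refl
  ... | no _  = m≤n⇒m≤1+n (n≤1+n _)
  dist-lipschitz (inj₁ j) up       = ≤-refl
  dist-lipschitz (inj₂ j) (up {i}) with i ≟ j
  ... | yes _ = z≤n
  ... | no _  = ≤-refl

  -- Listing indices in H lets adjacency and distinctness of internal vertices be carried over to H,
  -- where colours are assigned.
  ThroughCore : ∀ {u v} → Walk G u v → Set
  ThroughCore w = ∃ λ is → drop 1 (sources G w) ≡ map core is

  -- Of two distinct vertices in one part neither can be the hub, which is alone in its part.
  ~hub : ∀ {i j} → i ≢ j → f i ≡ f j → i ~ hub
  ~hub {i} i≢j fi≡fj with i ≟ hub
  ... | yes refl  = contradiction (sym fi≡fj) (hub-alone (i≢j ∘ sym))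
  ... | no i≢hub = hub-alone i≢hub

  -- Climb from a pendant if necessary, cross H by an edge or via the hub, and descend if necessary.
  shortWalk : ∀ x y → x ≢ y →
    Σ (Walk G ⟦ x ⟧ ⟦ y ⟧) λ w → length (sources G w) ≤ dist x y × ThroughCore w
  shortWalk (inj₁ i) (inj₁ j) x≢y with i ≟ j | f i ≟ f j
  ... | yes refl | _     = contradiction refl x≢y
  ... | no _     | no r  = edge (base r) ◅ ε , ≤-refl , [] , refl
  ... | no i≢j   | yes q =
    edge (base (~hub i≢j q)) ◅ edge (base (~hub (i≢j ∘ sym) (sym q) ∘ sym)) ◅ ε ,
    ≤-refl , hub ∷ [] , refl
  shortWalk (inj₁ i) (inj₂ j) _ with i ≟ j | f i ≟ f j
  ... | yes refl | _     = edge down ◅ ε , ≤-refl , [] , refl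
  ... | no _     | no r  = edge (base r) ◅ edge down ◅ ε , ≤-refl , j ∷ [] , refl
  ... | no i≢j   | yes q =
    edge (base (~hub i≢j q)) ◅ edge (base (~hub (i≢j ∘ sym) (sym q) ∘ sym)) ◅ edge down ◅ ε ,
    ≤-refl , hub ∷ j ∷ [] , refl
  shortWalk (inj₂ i) (inj₁ j) _ with i ≟ j | f i ≟ f j
  ... | yes refl | _     = edge up ◅ ε , ≤-refl , [] , refl
  ... | no _     | no r  = edge up ◅ edge (base r) ◅ ε , ≤-refl , i ∷ [] , refl
  ... | no i≢j   | yes q =
    edge up ◅ edge (base (~hub i≢j q)) ◅ edge (base (~hub (i≢j ∘ sym) (sym q) ∘ sym)) ◅ ε ,
    ≤-refl , i ∷ hub ∷ [] , refl
  shortWalk (inj₂ i) (inj₂ j) x≢y with i ≟ j | f i ≟ f j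
  ... | yes refl | _     = contradiction refl x≢y
  ... | no _     | no r  =
    edge up ◅ edge (base r) ◅ edge down ◅ ε , ≤-refl , i ∷ j ∷ [] , refl
  ... | no i≢j   | yes q =
    edge up ◅ edge (base (~hub i≢j q)) ◅ edge (base (~hub (i≢j ∘ sym) (sym q) ∘ sym)) ◅
    edge down ◅ ε ,
    ≤-refl , i ∷ hub ∷ j ∷ [] , refl

  CoreGeodesic : Rel Vertex 0ℓ
  CoreGeodesic u v = Σ (Path G u v) λ p → IsGeodesic G p × ThroughCore (proj₁ p)

  -- The walk from `shortWalk` attains the lower bound that `dist` puts on the distance.
  coreGeodesic : ∀ u v → u ≢ v → CoreGeodesic u v
  coreGeodesic u v u≢v =
    subst₂ CoreGeodesic (⟦⟧-view u) (⟦⟧-view v) (geodesic (view u) (view v) view-≢)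
    where
    view-≢ : view u ≢ view v
    view-≢ eq = u≢v (trans (view≡⇒≡ eq) (⟦⟧-view v))

    geodesic : ∀ x y → x ≢ y → CoreGeodesic ⟦ x ⟧ ⟦ y ⟧
    geodesic x y x≢y =
      let w , short , core-w = shortWalk x y x≢y
          tight = subst (λ z → length (sources G w) ≤ dist z y) (sym (view-⟦⟧ x)) short
      in (w , tight⇒unique G D D-y (dist-lipschitz y) w tight) ,
         tight⇒geodesic G D D-y (dist-lipschitz y) w tight , core-w
      where
      D : Vertex → ℕ
      D z = dist (view z) y

      D-y : D ⟦ y ⟧ ≡ 0
      D-y = trans (cong (λ z → dist z y) (view-⟦⟧ y)) (dist-refl y)

  connected : Connected G
  connected = nonZeroIndex (core hub) , path
    where
    path : ∀ u v → Path G u v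
    path u v with u ≟ v
    ... | yes refl = ε , [] ∷ []
    ... | no u≢v  = proj₁ (coreGeodesic u v u≢v)

  -- Colourings that suffice.

  colour : ∀ {k} → (Fin n → Fin k) → Coloring G k
  colour c = c ∘ [ id , id ]′ ∘ view

  colour-core : ∀ {k} (c : Fin n → Fin k) i → colour c (core i) ≡ c i
  colour-core c i = cong (c ∘ [ id , id ]′) (view-⟦⟧ (inj₁ i))

  colour-core-≢ : ∀ {k} (c : Fin n → Fin k) {i j} → c i ≢ c j → colour c (core i) ≢ colour c (core j)
  colour-core-≢ c {i} {j} = subst₂ _≢_ (sym (colour-core c i)) (sym (colour-core c j))

  core-adj⇒~ : ∀ {i j} → Adj (core i) (core j) → i ~ j
  core-adj⇒~ {i} {j} e with subst₂ E (view-⟦⟧ (inj₁ i)) (view-⟦⟧ (inj₁ j)) e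
  ... | base r = r

  -- Consecutive internal vertices are adjacent in H, so they lie in different parts.
  proper : StrongProperVertexConnected G (colour f)
  proper u v u≢v =
    let p , p-geodesic , is , internal≡ = coreGeodesic u v u≢v
        linked = Linked.map⁻ (subst (Linked Adj) internal≡ (internal-linked G p))
    in p , p-geodesic ,
       subst (Linked _) (sym internal≡)
         (Linked.map⁺ (Linked.map (colour-core-≢ f ∘ core-adj⇒~) linked))

  rainbow : StrongRainbowVertexConnected G (colour id)
  rainbow u v u≢v =
    let p , p-geodesic , is , internal≡ = coreGeodesic u v u≢v
        unique = AllPairs.map⁻ (subst Unique internal≡ (internal-unique G p))
    in p , p-geodesic ,
       subst (AllPairs _) (sym internal≡)
         (AllPairs.map⁺ (AllPairs.map (λ ci≢cj → colour-core-≢ id (ci≢cj ∘ cong core)) unique))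

  -- Lower bounds on the number of colours.

  up-target : ∀ {x y i} → E x y → x ≡ inj₂ i → y ≡ inj₁ i
  up-target up refl = refl

  down-source : ∀ {x y j} → E x y → y ≡ inj₂ j → x ≡ inj₁ j
  down-source down refl = refl

  inj₁≢inj₂ : ∀ {x : V} {i j} → x ≡ inj₁ i → x ≢ inj₂ j
  inj₁≢inj₂ refl ()

  pendant-≢ : ∀ {i j} → i ≢ j → ⟦ inj₂ i ⟧ ≢ ⟦ inj₂ j ⟧
  pendant-≢ i≢j = i≢j ∘ inj₂-injective ∘ ⟦⟧-injective

  -- The last edge into a pendant leaves from its base vertex.
  core∈sources : ∀ {u z v j} (e : Adj u z) (w : Walk G z v) → view v ≡ inj₂ j →
    core j ∈ sources G (e ◅ w)
  core∈sources e ε        v≡j = here (sym (view≡⇒≡ (down-source e v≡j)))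
  core∈sources e (e′ ◅ w) v≡j = there (core∈sources e′ w v≡j)

  rainbow⇒≢ : ∀ {k} (c : Coloring G k) {u v i j} (p : Path G u v) →
    view u ≡ inj₂ i → view v ≡ inj₂ j → i ≢ j →
    VertexRainbow G c p → c (core i) ≢ c (core j)
  rainbow⇒≢ c (ε , _) u≡i v≡j i≢j _ =
    contradiction (inj₂-injective (trans (sym u≡i) v≡j)) i≢j
  rainbow⇒≢ c (e ◅ ε , _) u≡i v≡j i≢j _ =
    contradiction v≡j (inj₁≢inj₂ (up-target e u≡i))
  rainbow⇒≢ c (e ◅ e′ ◅ ε , _) u≡i v≡j i≢j _ =
    contradiction (inj₁-injective (trans (sym (up-target e u≡i)) (down-source e′ v≡j))) i≢j
  -- The first internal vertex is `core i`, and `core j` is among the later ones.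
  rainbow⇒≢ c (e ◅ _ ◅ e″ ◅ w , _) u≡i v≡j i≢j (c≢ ∷ _) =
    subst (λ z → c z ≢ _) (view≡⇒≡ (up-target e u≡i)) (All.lookup c≢ (core∈sources e″ w v≡j))

  -- With length at most three there are at most two internal vertices, so proper and rainbow
  -- coincide.
  proper⇒≢ : ∀ {k} (c : Coloring G k) {u v i j} (p : Path G u v) →
    view u ≡ inj₂ i → view v ≡ inj₂ j → i ≢ j → pathLength G p ≤ 3 →
    VertexProper G c p → c (core i) ≢ c (core j)
  proper⇒≢ c (_ ◅ _ ◅ _ ◅ _ ◅ _ , _) _ _ _ (s≤s (s≤s (s≤s ()))) _
  proper⇒≢ c p@(ε , _)               u≡i v≡j i≢j _ _ = rainbow⇒≢ c p u≡i v≡j i≢j []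
  proper⇒≢ c p@(_ ◅ ε , _)           u≡i v≡j i≢j _ _ = rainbow⇒≢ c p u≡i v≡j i≢j []
  proper⇒≢ c p@(_ ◅ _ ◅ ε , _)       u≡i v≡j i≢j _ _ = rainbow⇒≢ c p u≡i v≡j i≢j ([] ∷ [])
  proper⇒≢ c p@(_ ◅ _ ◅ _ ◅ ε , _)   u≡i v≡j i≢j _ (r ∷ [-]) =
    rainbow⇒≢ c p u≡i v≡j i≢j ((r ∷ []) ∷ [] ∷ [])

  isSrvc : IsSrvc G n
  isSrvc = (colour id , rainbow) , λ k (c , c-rainbow) →
    reflects-≢⇒≤ (c ∘ core) λ {i} {j} i≢j →
      let p , _ , p-rainbow = c-rainbow ⟦ inj₂ i ⟧ ⟦ inj₂ j ⟧ (pendant-≢ i≢j)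
      in rainbow⇒≢ c p (view-⟦⟧ (inj₂ i)) (view-⟦⟧ (inj₂ j)) i≢j p-rainbow

  -- This caps the length of a geodesic between the two pendants at three, as `proper⇒≢` requires.
  pendantPath : ∀ {i j} → i ~ j → Σ (Path G ⟦ inj₂ i ⟧ ⟦ inj₂ j ⟧) λ p → pathLength G p ≡ 3
  pendantPath {i} {j} r =
    (edge up ◅ edge (base r) ◅ edge down ◅ ε , Unique.map⁺ ⟦⟧-injective distinct) , refl
    where
    i≢j : i ≢ j
    i≢j = r ∘ cong f

    distinct : Unique (inj₂ i ∷ inj₁ i ∷ inj₁ j ∷ inj₂ j ∷ [])
    distinct =
      ((λ ()) ∷ (λ ()) ∷ i≢j ∘ inj₂-injective ∷ []) ∷
      (i≢j ∘ inj₁-injective ∷ (λ ()) ∷ []) ∷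
      ((λ ()) ∷ []) ∷ [] ∷ []

  -- The map `g` picks a vertex from each part. These `a` vertices form a clique of H, so their
  -- colours must all differ.
  isSpvc : (g : Fin a → Fin n) → (∀ s → f (g s) ≡ s) → IsSpvc G a
  isSpvc g f∘g = (colour f , proper) , λ k (c , c-proper) →
    reflects-≢⇒≤ (c ∘ core ∘ g) λ {s} {t} s≢t →
      let r = subst₂ _≢_ (sym (f∘g s)) (sym (f∘g t)) s≢t
          g≢ = r ∘ cong f
          p , (_ , least) , p-proper = c-proper ⟦ inj₂ (g s) ⟧ ⟦ inj₂ (g t) ⟧ (pendant-≢ g≢)
      in proper⇒≢ c p (view-⟦⟧ (inj₂ (g s))) (view-⟦⟧ (inj₂ (g t))) g≢
           (least 3 (pendantPath r)) p-proper

theorem8 : ∀ (a b : ℕ) → 2 ≤ a → a ≤ b →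
    Σ Graph λ G → Connected G × IsSpvc G a × IsSrvc G b
theorem8 (suc (suc m)) (suc n) (s≤s (s≤s _)) a≤b =
  G , connected , isSpvc (λ s → inject≤ s a≤b) part-inject≤ , isSrvc
  where
  part : Fin (suc n) → Fin (suc (suc m))
  -- Vertices up to `suc m` represent the parts in order; all later ones join the last part.
  part i = fromℕ< (s≤s (m⊓n≤n (toℕ i) (suc m)))

  part-alone : ∀ {i} → i ≢ zero → part i ≢ part zero
  part-alone {zero}  0≢0 = contradiction refl 0≢0
  -- The cap `suc m` is positive because `a` is at least 2, so a nonzero vertex never falls into
  -- part zero.
  part-alone {suc _} _   = λ ()

  part-inject≤ : ∀ s → part (inject≤ s a≤b) ≡ s
  part-inject≤ s = toℕ-injective (trans (toℕ-fromℕ< _)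
    (trans (cong (_⊓ suc m) (toℕ-inject≤ s a≤b)) (m≤n⇒m⊓n≡m (toℕ≤pred[n] s))))

  open Corona part zero part-alone
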